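{- Let $q$ be a power of a prime, let $b \in \mathbb{N}$, and let $F:\mathbb{F}_q^{3b} \rightarrow \mathbb{F}_q^b$ be a linear bipermutive cellular automaton (LBCA) with local rule $f: \mathbb{F}_q^{2b+1}\rightarrow \mathbb{F}_q$ defined for all $x \in \mathbb{F}_q^{2b+1}$ as $$f(x_1,\ldots,x_{2b+1}) = x_1 + a_2x_2 + \cdots + a_{2b}x_{2b} + x_{2b+1},$$ where $a_2,\ldots,a_{2b}\in\mathbb{F}_q$. Then the hypercube $\mathcal{H}_F$ associated to $F$ is a Latin cube of order $q^b$ if and only if the $b\times b$ Toeplitz matrix $$M_F = \begin{pmatrix} a_{b+1} & a_{b+2} & \cdots & a_{2b} \\ a_{b} & a_{b+1} & \cdots & a_{2b-1} \\ \vdots & \vdots & \ddots & \vdots \\ a_2 & a_3 & \cdots & a_{b+1} \end{pmatrix}$$ (whose $(r,c)$ entry is $a_{b+1+c-r}$) is invertible.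
   Context: $\mathbb{N}$ denotes the positive integers, $\mathbb{F}_q$ is the finite field with $q$ elements, and $[N]=\{1,\ldots,N\}$. Latin hypercube: for a finite set $X$ of $N$ elements, a Latin hypercube of dimension $k$ and order $N$ over $X$ is a $k$-dimensional array with entries from $X$ such that, whenever any $k-1$ of the $k$ coordinates are fixed, letting the remaining coordinate vary yields a permutation of $X$ (each element of $X$ appears exactly once). A Latin cube is a Latin hypercube of dimension $3$. Cellular automaton (CA): for $d\le n$ and $f:\mathbb{F}_q^d\to\mathbb{F}_q$, the CA of length $n$ and local rule $f$ is the map $F:\mathbb{F}_q^n\to\mathbb{F}_q^{n-d+1}$ with $F(x_1,\ldots,x_n) = (f(x_1,\ldots,x_d), f(x_2,\ldots,x_{d+1}),\ldots,f(x_{n-d+1},\ldots,x_n))$. LBCA: a CA whose local rule is of the form $f(x_1,\ldots,x_d)=x_1+a_2x_2+\cdots+a_{d-1}x_{d-1}+x_d$ with $a_2,\ldots,a_{d-1}\in\mathbb{F}_q$ (first and last coefficients equal to $1$). Hypercube associated to a CA: the vectors in $\mathbb{F}_q^b$ are totally ordered, and $\Psi:[N]\to\mathbb{F}_q^b$, $N=q^b$, is the fixed monotone bijection. For a CA $F:\mathbb{F}_q^{bk}\to\mathbb{F}_q^b$ with local rule of $d=b(k-1)+1$ variables, $\mathcal{H}_F$ is the $k$-dimensional array of order $q^b$ with entries $\mathcal{H}_F(i_1,\ldots,i_k)=\Psi^{ -1}(F(\Psi(i_1)\,\|\,\cdots\,\|\,\Psi(i_k)))$ for $(i_1,\ldots,i_k)\in[N]^k$,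 where $\|$ is concatenation. Here $k=3$. -}

module Defs where

open import Algebra.Apartness.Bundles using (HeytingField; HeytingCommutativeRing)
open import Algebra.Bundles using (CommutativeRing)
open import Algebra.Definitions using (Invertible)
import Algebra.Properties.Semiring.Sum as Sum
open import Data.Bool.Base using (if_then_else_)
open import Data.Fin.Base using (Fin; suc; toℕ; fromℕ<; inject₁)
  renaming (_≤_ to _≤ᶠ_)
open import Data.Fin.Properties using (toℕ<n; _≟_)
open import Data.Nat.Base
  using (ℕ; suc; _+_; _*_; _∸_; _<_; NonZero)
open import Data.Nat.Properties
  using (+-suc; +-mono-≤; +-monoʳ-<; +-identityʳ; m∸n≤m; ≤-pred; module ≤-Reasoning)
open import Data.Product.Base using (proj₁)
open import Data.Vec.Functional using (Vector; head; last; concat; updateAt; map)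
open import Data.Vec.Functional.Relation.Binary.Pointwise using (Pointwise)
open import Function.Base using (const)
open import Function.Bundles using (Inverse)
open import Function.Definitions using (Bijective)
open import Level using (Level; _⊔_)
  renaming (suc to lsuc)
open import Relation.Binary.Core using (Rel)
open import Relation.Binary.Morphism.Structures using (IsOrderIsomorphism)
open import Relation.Binary.PropositionalEquality
  using (_≡_; cong; setoid)
open import Relation.Nullary.Decidable using (does)

private
  variable
    a ℓ ℓ′ : Level
    A X : Set a
    b d k m n N : ℕ

-- Finiteness makes the equality decidable, so that the tight apartness of
-- the Heyting field is just x ≉ y and every nonzero element is invertible.
record FiniteField c ℓ₁ ℓ₂ (q : ℕ) : Set (lsuc (c ⊔ ℓ₁ ⊔ ℓ₂)) where
  field
    heytingField : HeytingField c ℓ₁ ℓ₂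

  open HeytingField heytingField using (heytingCommutativeRing)

  commutativeRing : CommutativeRing c ℓ₁
  commutativeRing = HeytingCommutativeRing.commutativeRing heytingCommutativeRing

  field
    enumeration : Inverse (setoid (Fin q)) (CommutativeRing.setoid commutativeRing)

  open CommutativeRing commutativeRing public using (Carrier; _≈_)

  infix 4 _≋_

  _≋_ : Rel (Vector Carrier n) ℓ₁
  _≋_ = Pointwise _≈_

-- For k ≥ 1 the bijections force X to have exactly N elements.
IsLatinHypercube : {X : Set a} → (Vector (Fin N) k → X) → Set a
IsLatinHypercube {N = N} {k = k} H =
  (i : Vector (Fin N) k) (j : Fin k) →
  Bijective _≡_ _≡_ (λ x → H (updateAt i j (const x)))

IsLatinCube : {X : Set a} → (Vector (Fin N) 3 → X) → Set a
IsLatinCube = IsLatinHypercube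

window-< : m + d ≡ suc n → (i : Fin m) (j : Fin d) → toℕ i + toℕ j < n
window-< {m} {d} {n} eq i j = ≤-pred (begin
  suc (suc (toℕ i + toℕ j))  ≡⟨ cong suc (+-suc (toℕ i) (toℕ j)) ⟨
  suc (toℕ i) + suc (toℕ j)  ≤⟨ +-mono-≤ (toℕ<n i) (toℕ<n j) ⟩
  m + d                      ≡⟨ eq ⟩
  suc n                      ∎)
  where open ≤-Reasoning

-- The equation says that the output length m is n - d + 1.
cellularAutomaton : .(m + d ≡ suc n) → (Vector A d → A) → Vector A n → Vector A m
cellularAutomaton eq f x i = f (λ j → x (fromℕ< (window-< eq i j)))

-- Ψ⁻¹ is read off from the surjectivity of Ψ.
hypercube : {_≈_ : Rel (Vector A b) ℓ} {_≲_ : Rel (Vector A b) ℓ′}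
            {Ψ : Fin N → Vector A b} →
            IsOrderIsomorphism _≡_ _≈_ _≤ᶠ_ _≲_ Ψ →
            (Vector A (k * b) → Vector A b) →
            Vector (Fin N) k → Fin N
hypercube {Ψ = Ψ} Ψ-iso F i =
  proj₁ (IsOrderIsomorphism.surjective Ψ-iso (F (concat (map Ψ i))))

lbca-length : ∀ b .{{_ : NonZero b}} → b + (2 + (2 * b ∸ 1)) ≡ suc (3 * b)
lbca-length b@(suc b′) = +-suc b (2 * b)

toeplitz-< : (r c : Fin b) → (b + toℕ c) ∸ suc (toℕ r) < 2 * b ∸ 1
toeplitz-< {b@(suc b′)} r c = begin-strict
    (b′ + toℕ c) ∸ toℕ r  ≤⟨ m∸n≤m (b′ + toℕ c) (toℕ r) ⟩
    b′ + toℕ c            <⟨ +-monoʳ-< b′ (toℕ<n c) ⟩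
    b′ + b                ≡⟨ cong (b′ +_) (+-identityʳ b) ⟨
    b′ + (b + 0)          ∎
  where open ≤-Reasoning

module Linear {c ℓ} (R : CommutativeRing c ℓ) where
  open CommutativeRing R
    using (Carrier; _≈_; 0#; 1#; semiring)
    renaming (_+_ to _⊕_; _*_ to _⊗_)
  open Sum semiring using (sum)

  -- The entry of a at 0-based position j is the coefficient a_{j+2}.
  bipermutiveRule : Vector Carrier m → Vector Carrier (2 + m) → Carrier
  bipermutiveRule a x =
    (head x ⊕ sum (λ j → a j ⊗ x (suc (inject₁ j)))) ⊕ last x

  -- The local rule has 2 + (2 * b ∸ 1) = 2b + 1 variables.
  lbca : ∀ b .{{_ : NonZero b}} → Vector Carrier (2 * b ∸ 1) →
         Vector Carrier (3 * b) → Vector Carrier b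
  lbca b a = cellularAutomaton (lbca-length b) (bipermutiveRule a)

  SquareMatrix : ℕ → Set c
  SquareMatrix n = Fin n → Fin n → Carrier

  _≈ᴹ_ : Rel (SquareMatrix n) ℓ
  M ≈ᴹ M′ = ∀ r c → M r c ≈ M′ r c

  _·_ : SquareMatrix n → SquareMatrix n → SquareMatrix n
  (M · M′) r c = sum (λ j → M r j ⊗ M′ j c)

  identity : SquareMatrix n
  identity r c = if does (r ≟ c) then 1# else 0#

  IsInvertibleMatrix : SquareMatrix n → Set (c ⊔ ℓ)
  IsInvertibleMatrix = Invertible _≈ᴹ_ identity _·_

  -- With 1-based r and c the entry is a_{b+1+c-r}; c - r does not depend on
  -- the base, and a_{b+1+c-r} is stored at position b+1+c-r-2.
  toeplitz : ∀ b → Vector Carrier (2 * b ∸ 1) → SquareMatrix b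
  toeplitz b a r c = a (fromℕ< (toeplitz-< r c))

{-# OPTIONS --safe #-}
-- Let F act on three blocks (x , y , z).  Since the first (last)
-- coefficient of the local rule is 1, x (resp. z) can be recovered from
-- F (x , y , z) and the other two blocks cell by cell from right to left
-- (left to right), so lines along the outer axes are injective, and hence
-- bijective by finiteness.  Along the middle axis, F (x , y , z) is
-- F (x , 0 , z) + M_F y, so those lines are bijective iff y ↦ M_F y is,
-- that is, iff M_F is invertible.
module Submission where

open import Defs
open import Algebra.Bundles using (CommutativeRing)
import Algebra.Properties.AbelianGroup as AbelianGroupProperties
import Algebra.Properties.CommutativeSemigroup as CommutativeSemigroupProperties
import Algebra.Properties.Semiring.Sum as Sum
open import Data.Bool.Base using (if_then_else_)
open import Data.Fin.Base using (Fin; zero; suc; toℕ; fromℕ; fromℕ<; inject₁; combine; punchIn; punchOut)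
  renaming (_≤_ to _≤ᶠ_; _<_ to _<ᶠ_; _>_ to _>ᶠ_)
open import Data.Fin.Induction using (<-wellFounded; >-wellFounded)
open import Data.Fin.Patterns using (0F; 1F; 2F)
open import Data.Fin.Properties
  using (toℕ<n; _≟_; any?; punchOut-injective; injective⇒≤; toℕ-injective; toℕ-fromℕ<; toℕ-fromℕ;
         toℕ-inject₁; toℕ-combine; fromℕ<-cong; combine-surjective; remQuot-combine; punchInᵢ≢i)
open import Data.Nat.Base using (ℕ; zero; suc; _+_; _*_; _∸_; _^_; _≤_; _<_; z≤n; s≤s; s≤s⁻¹;
  NonZero; >-nonZero⁻¹)
open import Data.Nat.Primality using (Prime)
import Data.Nat.Properties as ℕ
open import Data.Product.Base using (_,_; proj₁; proj₂; ∃; uncurry)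
open import Data.Vec.Functional using (Vector; concat; map; updateAt)
import Data.Vec.Functional.Relation.Binary.Equality.Setoid as VecEquality
open import Function.Base using (const; _∘_)
open import Function.Bundles using (_⇔_; mk⇔)
open import Function.Definitions using (Injective; Surjective; Bijective)
open import Induction.WellFounded using (Acc; acc)
open import Level using (Level)
open import Relation.Binary.Core using (Rel)
open import Relation.Binary.Morphism.Structures using (IsOrderIsomorphism)
open import Relation.Binary.PropositionalEquality as ≡ using (_≡_; _≢_)
import Relation.Binary.Reasoning.Setoid as SetoidReasoning
open import Relation.Binary.Structures using (IsTotalOrder)
open import Relation.Nullary.Decidable using (yes; no; dec-true; dec-false)
open import Relation.Nullary.Negation using (contradiction)

private
  variable
    α ℓ : Level
    A : Set α
    b d m n : ℕ

-- Injective self-maps of a finite set.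

injective⇒surjective : {f : Fin n → Fin n} → Injective _≡_ _≡_ f → Surjective _≡_ _≡_ f
injective⇒surjective {suc n} {f} inj y with any? (λ x → f x ≟ y)
... | yes (x , fx≡y) = x , λ { ≡.refl → fx≡y }
-- If `y` were missed, removing it from the codomain would inject `Fin (suc n)` into `Fin n`.
... | no ∄x = contradiction (injective⇒≤ punchOut∘f-injective) ℕ.1+n≰n
  where
  y≢f : ∀ x → y ≢ f x
  y≢f x y≡fx = ∄x (x , ≡.sym y≡fx)

  punchOut∘f-injective : Injective _≡_ _≡_ (λ x → punchOut (y≢f x))
  punchOut∘f-injective eq = inj (punchOut-injective (y≢f _) (y≢f _) eq)

-- Positions in a concatenation of equal blocks.

concat-combine : (xss : Vector (Vector A n) m) (i : Fin m) (j : Fin n) →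
                 concat xss (combine i j) ≡ xss i j
concat-combine {n = n} {m} xss i j = ≡.cong (uncurry xss) (remQuot-combine {m} {n} i j)

-- Serves positions that come from a window and are known by their numerical value, not as a
-- `combine`.
concat-at : (xss : Vector (Vector A n) m) (i : Fin m) (j : Fin n) {k : Fin (m * n)} →
            toℕ k ≡ n * toℕ i + toℕ j → concat xss k ≡ xss i j
concat-at xss i j k≡ = ≡.trans
  (≡.cong (concat xss) (toℕ-injective (≡.trans k≡ (≡.sym (toℕ-combine i j)))))
  (concat-combine xss i j)

toℕ-combine-< : (i : Fin m) (j : Fin n) → toℕ (combine i j) < suc (toℕ i) * n
toℕ-combine-< {n = n} i j = begin-strict
  toℕ (combine i j)    ≡⟨ toℕ-combine i j ⟩
  n * toℕ i + toℕ j    <⟨ ℕ.+-monoʳ-< (n * toℕ i) (toℕ<n j) ⟩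
  n * toℕ i + n        ≡⟨ ℕ.+-comm (n * toℕ i) n ⟩
  n + n * toℕ i        ≡⟨ ≡.cong (n +_) (ℕ.*-comm n (toℕ i)) ⟩
  suc (toℕ i) * n      ∎
  where open ℕ.≤-Reasoning

toℕ-combine-≥ : (i : Fin m) (j : Fin n) → toℕ i * n ≤ toℕ (combine i j)
toℕ-combine-≥ {n = n} i j = begin
  toℕ i * n            ≡⟨ ℕ.*-comm (toℕ i) n ⟩
  n * toℕ i            ≤⟨ ℕ.m≤m+n (n * toℕ i) (toℕ j) ⟩
  n * toℕ i + toℕ j    ≡⟨ toℕ-combine i j ⟨
  toℕ (combine i j)    ∎
  where open ℕ.≤-Reasoning

-- Lets a pointwise claim about a concatenation be proved by cases on the block index.
combine-elim : ∀ m {n} (P : Fin (m * n) → Set ℓ) → (∀ i j → P (combine i j)) → ∀ k → P k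
combine-elim m {n} P p k with i , j , eq ← combine-surjective {m} {n} k = ≡.subst P eq (p i j)

-- Names the index read by `cellularAutomaton`, so that `cellularAutomaton eq f x i` is
-- `f (x ∘ windowPosition eq i)` by definition.
windowPosition : .(m + d ≡ suc n) → Fin m → Fin d → Fin n
windowPosition eq i j = fromℕ< (window-< eq i j)

toℕ-windowPosition : .(eq : m + d ≡ suc n) (i : Fin m) (j : Fin d) →
                     toℕ (windowPosition eq i j) ≡ toℕ i + toℕ j
toℕ-windowPosition eq i j = toℕ-fromℕ< (window-< eq i j)

-- Recovering the outer cells of a cellular automaton's input.

module _ {A : Set α} (_≈_ : Rel A ℓ) where

  -- The injective half of permutivity in the leftmost variable; finiteness later turns injective
  -- lines into bijective ones.
  LeftCancellative : (Vector A (suc d) → A) → Set _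
  LeftCancellative f = ∀ x y → (∀ j → x (suc j) ≈ y (suc j)) → f x ≈ f y → x zero ≈ y zero

  RightCancellative : (Vector A (suc d) → A) → Set _
  RightCancellative {d} f =
    ∀ x y → (∀ j → x (inject₁ j) ≈ y (inject₁ j)) → f x ≈ f y → x (fromℕ d) ≈ y (fromℕ d)

  module _ (eq : m + suc d ≡ suc n) {f : Vector A (suc d) → A} {w w′ : Vector A n} where

    private
      position : Fin m → Fin (suc d) → Fin n
      position = windowPosition eq

    -- Induction from the right end: a cell `k` below `m` is the first cell of window `k`, and the
    -- rest of that window lies further right, where agreement is already known.
    cellularAutomaton-cancelˡ :
      LeftCancellative f → (∀ k → m ≤ toℕ k → w k ≈ w′ k) →
      (∀ i → cellularAutomaton eq f w i ≈ cellularAutomaton eq f w′ i) → ∀ k → w k ≈ w′ k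
    cellularAutomaton-cancelˡ cancel agree Fw≈Fw′ k = go k (>-wellFounded k)
      where
      go : ∀ k → Acc _>ᶠ_ k → w k ≈ w′ k
      go k (acc rs) with m ℕ.≤? toℕ k
      ... | yes m≤k = agree k m≤k
      ... | no m≰k = ≡.subst (λ k → w k ≈ w′ k) position≡k
              (cancel (w ∘ position i) (w′ ∘ position i) (λ j → go (position i (suc j)) (rs (k<position j))) (Fw≈Fw′ i))
        where
        i : Fin m
        i = fromℕ< (ℕ.≰⇒> m≰k)

        toℕ-i : toℕ i ≡ toℕ k
        toℕ-i = toℕ-fromℕ< (ℕ.≰⇒> m≰k)

        position≡k : position i zero ≡ k
        position≡k = toℕ-injective
          (≡.trans (toℕ-windowPosition eq i zero) (≡.trans (ℕ.+-identityʳ (toℕ i)) toℕ-i))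

        k<position : ∀ j → k <ᶠ position i (suc j)
        k<position j = begin-strict
          toℕ k                       ≡⟨ toℕ-i ⟨
          toℕ i                       <⟨ ℕ.m<m+n (toℕ i) (s≤s z≤n) ⟩
          toℕ i + toℕ (suc j)         ≡⟨ toℕ-windowPosition eq i (suc j) ⟨
          toℕ (position i (suc j))    ∎
          where open ℕ.≤-Reasoning

    -- The mirror image, by induction from the left end: a cell `k` at or beyond `d` is the last
    -- cell of window `k ∸ d`, since windows have `suc d` cells.
    cellularAutomaton-cancelʳ :
      RightCancellative f → (∀ k → toℕ k < d → w k ≈ w′ k) →
      (∀ i → cellularAutomaton eq f w i ≈ cellularAutomaton eq f w′ i) → ∀ k → w k ≈ w′ k
    cellularAutomaton-cancelʳ cancel agree Fw≈Fw′ k = go k (<-wellFounded k)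
      where
      m+d≡n : m + d ≡ n
      m+d≡n = ℕ.suc-injective (≡.trans (≡.sym (ℕ.+-suc m d)) eq)

      go : ∀ k → Acc _<ᶠ_ k → w k ≈ w′ k
      go k (acc rs) with d ℕ.≤? toℕ k
      ... | no d≰k = agree k (ℕ.≰⇒> d≰k)
      ... | yes d≤k = ≡.subst (λ k → w k ≈ w′ k) position≡k
              (cancel (w ∘ position i) (w′ ∘ position i) (λ j → go (position i (inject₁ j)) (rs (position<k j))) (Fw≈Fw′ i))
        where
        k∸d<m : toℕ k ∸ d < m
        k∸d<m = ℕ.+-cancelʳ-< d (toℕ k ∸ d) m (begin-strict
          toℕ k ∸ d + d  ≡⟨ ℕ.m∸n+n≡m d≤k ⟩
          toℕ k          <⟨ toℕ<n k ⟩
          n              ≡⟨ m+d≡n ⟨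
          m + d          ∎)
          where open ℕ.≤-Reasoning

        i : Fin m
        i = fromℕ< k∸d<m

        i+d≡k : toℕ i + d ≡ toℕ k
        i+d≡k = ≡.trans (≡.cong (_+ d) (toℕ-fromℕ< k∸d<m)) (ℕ.m∸n+n≡m d≤k)

        position≡k : position i (fromℕ d) ≡ k
        position≡k = toℕ-injective (≡.trans (toℕ-windowPosition eq i (fromℕ d))
          (≡.trans (≡.cong (toℕ i +_) (toℕ-fromℕ d)) i+d≡k))

        position<k : ∀ j → position i (inject₁ j) <ᶠ k
        position<k j = begin-strict
          toℕ (position i (inject₁ j))  ≡⟨ toℕ-windowPosition eq i (inject₁ j) ⟩
          toℕ i + toℕ (inject₁ j)       ≡⟨ ≡.cong (toℕ i +_) (toℕ-inject₁ j) ⟩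
          toℕ i + toℕ j                 <⟨ ℕ.+-monoʳ-< (toℕ i) (toℕ<n j) ⟩
          toℕ i + d                     ≡⟨ i+d≡k ⟩
          toℕ k                         ∎
          where open ℕ.≤-Reasoning

-- Sums and square matrices over a commutative ring.

module _ {c ℓ} (R : CommutativeRing c ℓ) where
  open CommutativeRing R
    using (Carrier; _≈_; 0#; 1#; setoid; semiring; +-abelianGroup; +-commutativeSemigroup;
           +-cong; +-congˡ; +-congʳ; +-identityˡ; +-identityʳ; *-cong; *-congˡ; *-congʳ; *-assoc;
           *-identityˡ; *-identityʳ; zeroˡ; zeroʳ; distribˡ; refl; sym; trans; reflexive)
    renaming (_+_ to _⊕_; _*_ to _⊗_)
  open AbelianGroupProperties +-abelianGroup using (∙-cancelˡ; ∙-cancelʳ)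
  open CommutativeSemigroupProperties +-commutativeSemigroup using (interchange)
  open Sum semiring
  open Linear R
  open SetoidReasoning setoid
  open VecEquality setoid using (_≋_)

  infixr 7 _·ᵥ_
  _·ᵥ_ : SquareMatrix n → Vector Carrier n → Vector Carrier n
  (M ·ᵥ y) r = sum (λ j → M r j ⊗ y j)

  sum-zero : {f : Vector Carrier n} → (∀ j → f j ≈ 0#) → sum f ≈ 0#
  sum-zero {n} f≈0 = trans (sum-cong-≋ f≈0) (sum-replicate-zero n)

  sum-single : {f : Vector Carrier n} (i : Fin n) → (∀ j → j ≢ i → f j ≈ 0#) → sum f ≈ f i
  sum-single {suc n} {f} i f≈0 = begin
    sum f                                   ≈⟨ sum-remove {i = i} f ⟩
    f i ⊕ sum (λ j → f (punchIn i j))       ≈⟨ +-congˡ (sum-zero (λ j → f≈0 _ (punchInᵢ≢i i j))) ⟩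
    f i ⊕ 0#                                ≈⟨ +-identityʳ (f i) ⟩
    f i                                     ∎

  -- Terms are peeled off the front: first the `p` vanishing ones, then the `n` that are kept, until
  -- only the vanishing tail remains. It serves to discard the coefficients of the local rule that
  -- meet zero outer blocks.
  sum-window : ∀ p {n m} {f : Vector Carrier m} (p+n≤m : p + n ≤ m) →
               (∀ j → toℕ j < p → f j ≈ 0#) → (∀ j → p + n ≤ toℕ j → f j ≈ 0#) →
               sum f ≈ sum (λ (i : Fin n) → f (fromℕ< (ℕ.<-≤-trans (ℕ.+-monoʳ-< p (toℕ<n i)) p+n≤m)))
  sum-window zero    {zero}  p+n≤m before after = sum-zero (λ j → after j z≤n)
  sum-window zero    {suc n} {suc m} p+n≤m before after =
    +-congˡ (sum-window zero (s≤s⁻¹ p+n≤m) (λ j ()) (λ j n≤j → after (suc j) (s≤s n≤j)))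
  sum-window (suc p) {n} {suc m} p+n≤m before after =
    trans (+-congʳ (before zero (s≤s z≤n)))
    (trans (+-identityˡ _)
      (sum-window p (s≤s⁻¹ p+n≤m) (λ j j<p → before (suc j) (s≤s j<p))
                                  (λ j p+n≤j → after (suc j) (s≤s p+n≤j))))

  identity-diag : (i : Fin n) → identity i i ≈ 1#
  identity-diag i = reflexive (≡.cong (if_then 1# else 0#) (dec-true (i ≟ i) ≡.refl))

  identity-offDiag : {i j : Fin n} → i ≢ j → identity i j ≈ 0#
  identity-offDiag {i = i} {j} i≢j = reflexive (≡.cong (if_then 1# else 0#) (dec-false (i ≟ j) i≢j))

  identity-·ᵥ : (y : Vector Carrier n) → identity ·ᵥ y ≋ y
  identity-·ᵥ y i = begin
    sum (λ j → identity i j ⊗ y j)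
      ≈⟨ sum-single i (λ j j≢i → trans (*-congʳ (identity-offDiag (j≢i ∘ ≡.sym))) (zeroˡ (y j))) ⟩
    identity i i ⊗ y i              ≈⟨ *-congʳ (identity-diag i) ⟩
    1# ⊗ y i                        ≈⟨ *-identityˡ (y i) ⟩
    y i                             ∎

  ·-identityʳ : (M : SquareMatrix n) → (M · identity) ≈ᴹ M
  ·-identityʳ M r k = begin
    sum (λ j → M r j ⊗ identity j k)
      ≈⟨ sum-single k (λ j j≢k → trans (*-congˡ (identity-offDiag j≢k)) (zeroʳ (M r j))) ⟩
    M r k ⊗ identity k k             ≈⟨ *-congˡ (identity-diag k) ⟩
    M r k ⊗ 1#                       ≈⟨ *-identityʳ (M r k) ⟩
    M r k                            ∎

  ·ᵥ-congˡ : (M : SquareMatrix n) {x y : Vector Carrier n} → x ≋ y → M ·ᵥ x ≋ M ·ᵥ y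
  ·ᵥ-congˡ M x≋y r = sum-cong-≋ (λ j → *-congˡ (x≋y j))

  ·ᵥ-congʳ : {M M′ : SquareMatrix n} → M ≈ᴹ M′ → ∀ y → M ·ᵥ y ≋ M′ ·ᵥ y
  ·ᵥ-congʳ M≈M′ y r = sum-cong-≋ (λ j → *-congʳ (M≈M′ r j))

  ·ᵥ-assoc : (M M′ : SquareMatrix n) (y : Vector Carrier n) → (M · M′) ·ᵥ y ≋ M ·ᵥ M′ ·ᵥ y
  ·ᵥ-assoc M M′ y r = begin
    sum (λ j → sum (λ i → M r i ⊗ M′ i j) ⊗ y j)
      ≈⟨ sum-cong-≋ (λ j → *-distribʳ-sum (y j) (λ i → M r i ⊗ M′ i j)) ⟩
    sum (λ j → sum (λ i → M r i ⊗ M′ i j ⊗ y j))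
      ≈⟨ ∑-comm (λ j i → M r i ⊗ M′ i j ⊗ y j) ⟩
    sum (λ i → sum (λ j → M r i ⊗ M′ i j ⊗ y j))
      ≈⟨ sum-cong-≋ (λ i → sum-cong-≋ (λ j → *-assoc (M r i) (M′ i j) (y j))) ⟩
    sum (λ i → sum (λ j → M r i ⊗ (M′ i j ⊗ y j)))
      ≈⟨ sum-cong-≋ (λ i → *-distribˡ-sum (M r i) (λ j → M′ i j ⊗ y j)) ⟨
    sum (λ i → M r i ⊗ sum (λ j → M′ i j ⊗ y j))
      ∎

  invertible⇒injective : {M : SquareMatrix n} → IsInvertibleMatrix M → Injective _≋_ _≋_ (M ·ᵥ_)
  invertible⇒injective {M = M} (B , BM≈I , _) {x} {y} Mx≋My i = begin
    x i                ≈⟨ undo x ⟨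
    (B ·ᵥ M ·ᵥ x) i    ≈⟨ ·ᵥ-congˡ B Mx≋My i ⟩
    (B ·ᵥ M ·ᵥ y) i    ≈⟨ undo y ⟩
    y i                ∎
    where
    undo : ∀ z → (B ·ᵥ M ·ᵥ z) i ≈ z i
    undo z = begin
      (B ·ᵥ M ·ᵥ z) i      ≈⟨ ·ᵥ-assoc B M z i ⟨
      ((B · M) ·ᵥ z) i     ≈⟨ ·ᵥ-congʳ BM≈I z i ⟩
      (identity ·ᵥ z) i    ≈⟨ identity-·ᵥ z i ⟩
      z i                  ∎

  -- The columns of `B` are preimages of the standard basis vectors, which makes `B` a right inverse
  -- at once; no determinants are involved.
  bijective⇒invertible : {M : SquareMatrix n} → Injective _≋_ _≋_ (M ·ᵥ_) →
                         (∀ t → ∃ λ y → M ·ᵥ y ≋ t) → IsInvertibleMatrix M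
  bijective⇒invertible {n} {M} inj surj = B , BM≈I , MB≈I
    where
    B : SquareMatrix n
    B r k = proj₁ (surj (λ i → identity i k)) r

    MB≈I : (M · B) ≈ᴹ identity
    MB≈I r k = proj₂ (surj (λ i → identity i k)) r

    -- By injectivity it suffices that M (B M) = (M B) M = M = M I.
    BM≈I : (B · M) ≈ᴹ identity
    BM≈I r k = inj {λ i → (B · M) i k} {λ i → identity i k} (λ i → begin
      (M · (B · M)) i k                ≈⟨ ·ᵥ-assoc M B (λ j → M j k) i ⟨
      ((M · B) · M) i k                ≈⟨ ·ᵥ-congʳ MB≈I (λ j → M j k) i ⟩
      (identity · M) i k               ≈⟨ identity-·ᵥ (λ j → M j k) i ⟩
      M i k                            ≈⟨ ·-identityʳ M i k ⟨
      (M · identity) i k               ∎) r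

  -- Cancellation and additivity of the local rule.

  bipermutiveRule-cancelˡ : (a : Vector Carrier m) → LeftCancellative _≈_ (bipermutiveRule a)
  bipermutiveRule-cancelˡ a x y x≈y fx≈fy =
    -- Once the agreeing terms of `y` are replaced by those of `x`, both sides share the last
    -- summand and the inner sum, which are cancelled in turn.
    ∙-cancelʳ _ _ _ (∙-cancelʳ _ _ _ (trans fx≈fy (sym
      (+-cong (+-congˡ (sum-cong-≋ (λ j → *-congˡ (x≈y (inject₁ j))))) (x≈y (fromℕ _))))))

  bipermutiveRule-cancelʳ : (a : Vector Carrier m) → RightCancellative _≈_ (bipermutiveRule a)
  bipermutiveRule-cancelʳ a x y x≈y fx≈fy =
    ∙-cancelˡ _ _ _ (trans fx≈fy (sym
      (+-congʳ (+-cong (x≈y zero) (sum-cong-≋ (λ j → *-congˡ (x≈y (suc j))))))))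

  bipermutiveRule-cong : (a : Vector Carrier m) {x y : Vector Carrier (2 + m)} →
                         x ≋ y → bipermutiveRule a x ≈ bipermutiveRule a y
  bipermutiveRule-cong a x≋y =
    +-cong (+-cong (x≋y zero) (sum-cong-≋ (λ j → *-congˡ (x≋y (suc (inject₁ j)))))) (x≋y (fromℕ _))

  bipermutiveRule-+ : (a : Vector Carrier m) (x y : Vector Carrier (2 + m)) →
    bipermutiveRule a (λ j → x j ⊕ y j) ≈ bipermutiveRule a x ⊕ bipermutiveRule a y
  bipermutiveRule-+ {m} a x y = begin
    ((x zero ⊕ y zero) ⊕ sum (λ j → a j ⊗ (x (suc (inject₁ j)) ⊕ y (suc (inject₁ j))))) ⊕ (xₗ ⊕ yₗ)
      ≈⟨ +-congʳ (+-congˡ (trans (sum-cong-≋ (λ j → distribˡ (a j) _ _)) (∑-distrib-+ xₘ yₘ))) ⟩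
    ((x zero ⊕ y zero) ⊕ (sum xₘ ⊕ sum yₘ)) ⊕ (xₗ ⊕ yₗ)
      ≈⟨ +-congʳ (interchange _ _ _ _) ⟩
    ((x zero ⊕ sum xₘ) ⊕ (y zero ⊕ sum yₘ)) ⊕ (xₗ ⊕ yₗ)
      ≈⟨ interchange _ _ _ _ ⟩
    bipermutiveRule a x ⊕ bipermutiveRule a y
      ∎
    where
    xₘ = λ j → a j ⊗ x (suc (inject₁ j))
    yₘ = λ j → a j ⊗ y (suc (inject₁ j))
    xₗ = x (fromℕ (suc m))
    yₗ = y (fromℕ (suc m))

  -- The middle block and the Toeplitz matrix.

  onlyMiddle : Vector Carrier b → Vector (Vector Carrier b) 3
  onlyMiddle y = updateAt (const (const 0#)) 1F (const y)

  withoutMiddle : Vector (Vector Carrier b) 3 → Vector (Vector Carrier b) 3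
  withoutMiddle xss = updateAt xss 1F (const (const 0#))

  concat-onlyMiddle-below : (y : Vector Carrier b) (k : Fin (3 * b)) → toℕ k < b →
                            concat (onlyMiddle y) k ≡ 0#
  concat-onlyMiddle-below {b} y k k<b =
    concat-at (onlyMiddle y) 0F (fromℕ< k<b)
      (≡.trans (≡.sym (toℕ-fromℕ< k<b)) (≡.cong (_+ toℕ (fromℕ< k<b)) (≡.sym (ℕ.*-zeroʳ b))))

  concat-onlyMiddle-above : (y : Vector Carrier b) (k : Fin (3 * b)) → 2 * b ≤ toℕ k →
                            concat (onlyMiddle y) k ≡ 0#
  concat-onlyMiddle-above {b} y = combine-elim 3 (λ k → 2 * b ≤ toℕ k → concat (onlyMiddle y) k ≡ 0#)
    λ { 0F j _ → concat-combine (onlyMiddle y) 0F j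
      ; 1F j 2b≤k → contradiction 2b≤k (ℕ.<⇒≱ (toℕ-combine-< {3} 1F j))
      ; 2F j _ → concat-combine (onlyMiddle y) 2F j }

  module _ (b : ℕ) .{{_ : NonZero b}} (a : Vector Carrier (2 * b ∸ 1)) where

    private
      M : SquareMatrix b
      M = toeplitz b a

      F : Vector Carrier (3 * b) → Vector Carrier b
      F = lbca b a

    -- The truncated subtraction is exact because `b` is nonzero. The left side is also the 0-based
    -- position of the last variable of the local rule.
    suc[2b∸1]≡2b : suc (2 * b ∸ 1) ≡ 2 * b
    suc[2b∸1]≡2b = ℕ.m+[n∸m]≡n (ℕ.≤-trans (>-nonZero⁻¹ b) (ℕ.m≤m+n b (b + 0)))

    lbca-cong : {w w′ : Vector Carrier (3 * b)} → w ≋ w′ → F w ≋ F w′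
    lbca-cong {w} {w′} w≋w′ i = bipermutiveRule-cong a {w ∘ position} {w′ ∘ position} (λ j → w≋w′ (position j))
      where position = windowPosition (lbca-length b) i

    -- Window `i` starts in the left block and ends in the right one, so both unit coefficients meet
    -- zeros. The inner coefficients that meet the middle block are `b` consecutive entries of `a`,
    -- and these form row `i` of the Toeplitz matrix.
    lbca-onlyMiddle : (y : Vector Carrier b) → F (concat (onlyMiddle y)) ≋ M ·ᵥ y
    lbca-onlyMiddle y i = begin
      (v (position zero) ⊕ sum g) ⊕ v (position (fromℕ _))
        ≈⟨ +-cong (+-congʳ (reflexive (concat-onlyMiddle-below y _ first<b)))
                  (reflexive (concat-onlyMiddle-above y _ 2b≤last)) ⟩
      (0# ⊕ sum g) ⊕ 0#
        ≈⟨ trans (+-identityʳ _) (+-identityˡ _) ⟩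
      sum g
        ≈⟨ sum-window p p+b≤ (λ j → g-below j) (λ j → g-above j) ⟩
      sum (λ r → g (fromℕ< (ℕ.<-≤-trans (ℕ.+-monoʳ-< p (toℕ<n r)) p+b≤)))
        ≈⟨ sum-cong-≋ (λ r → *-cong (a-index r) (v-index r)) ⟩
      (M ·ᵥ y) i
        ∎
      where
      v : Vector Carrier (3 * b)
      v = concat (onlyMiddle y)

      position : Fin (2 + (2 * b ∸ 1)) → Fin (3 * b)
      position = windowPosition (lbca-length b) i

      toℕ-position : ∀ j → toℕ (position j) ≡ toℕ i + toℕ j
      toℕ-position = toℕ-windowPosition (lbca-length b) i

      toℕ-middle : ∀ j → toℕ (position (suc (inject₁ j))) ≡ suc (toℕ i) + toℕ j
      toℕ-middle j = ≡.trans (toℕ-position (suc (inject₁ j)))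
        (≡.trans (≡.cong (λ l → toℕ i + suc l) (toℕ-inject₁ j)) (ℕ.+-suc (toℕ i) (toℕ j)))

      g : Vector Carrier (2 * b ∸ 1)
      g j = a j ⊗ v (position (suc (inject₁ j)))

      -- The coefficient at index `j` reads cell `suc (toℕ i) + j`, so `p` is the index whose
      -- coefficient reads the first cell of the middle block.
      p : ℕ
      p = b ∸ suc (toℕ i)

      1+i+p≡b : suc (toℕ i) + p ≡ b
      1+i+p≡b = ℕ.m+[n∸m]≡n (toℕ<n i)

      1+i+p+b≡2b : suc (toℕ i) + (p + b) ≡ 2 * b
      1+i+p+b≡2b = ≡.trans (≡.sym (ℕ.+-assoc (suc (toℕ i)) p b))
        (≡.cong₂ _+_ 1+i+p≡b (≡.sym (ℕ.+-identityʳ b)))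

      p+b≤ : p + b ≤ 2 * b ∸ 1
      p+b≤ = s≤s⁻¹ (ℕ.≤-trans (s≤s (ℕ.m≤n+m (p + b) (toℕ i)))
        (ℕ.≤-reflexive (≡.trans 1+i+p+b≡2b (≡.sym suc[2b∸1]≡2b))))

      first<b : toℕ (position zero) < b
      first<b = ≡.subst (_< b) (≡.sym (≡.trans (toℕ-position zero) (ℕ.+-identityʳ (toℕ i)))) (toℕ<n i)

      2b≤last : 2 * b ≤ toℕ (position (fromℕ (suc (2 * b ∸ 1))))
      2b≤last = ≡.subst (2 * b ≤_)
        (≡.sym (≡.trans (toℕ-position (fromℕ _))
          (≡.cong (toℕ i +_) (≡.trans (toℕ-fromℕ _) suc[2b∸1]≡2b))))
        (ℕ.m≤n+m (2 * b) (toℕ i))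

      g-below : ∀ j → toℕ j < p → g j ≈ 0#
      g-below j j<p = trans (*-congˡ (reflexive (concat-onlyMiddle-below y _
        (≡.subst₂ _<_ (≡.sym (toℕ-middle j)) 1+i+p≡b (ℕ.+-monoʳ-< (suc (toℕ i)) j<p))))) (zeroʳ (a j))

      g-above : ∀ j → p + b ≤ toℕ j → g j ≈ 0#
      g-above j p+b≤j = trans (*-congˡ (reflexive (concat-onlyMiddle-above y _
        (≡.subst₂ _≤_ 1+i+p+b≡2b (≡.sym (toℕ-middle j)) (ℕ.+-monoʳ-≤ (suc (toℕ i)) p+b≤j))))) (zeroʳ (a j))

      module _ (r : Fin b) where

        p+r< : p + toℕ r < 2 * b ∸ 1
        p+r< = ℕ.<-≤-trans (ℕ.+-monoʳ-< p (toℕ<n r)) p+b≤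

        -- `(b ∸ suc i) + r` equals `(b + r) ∸ suc i` because `suc i ≤ b`, so nothing is lost to
        -- truncation.
        a-index : a (fromℕ< p+r<) ≈ M i r
        a-index = reflexive (≡.cong a (fromℕ<-cong _ _
          (≡.sym (ℕ.+-∸-comm (toℕ r) (toℕ<n i))) p+r< (toeplitz-< i r)))

        v-index : v (position (suc (inject₁ (fromℕ< p+r<)))) ≈ y r
        v-index = reflexive (concat-at (onlyMiddle y) 1F r (≡.trans (toℕ-middle (fromℕ< p+r<))
          (≡.trans (≡.cong (suc (toℕ i) +_) (toℕ-fromℕ< p+r<))
          (≡.trans (≡.sym (ℕ.+-assoc (suc (toℕ i)) p (toℕ r)))
          (≡.cong (_+ toℕ r) (≡.trans 1+i+p≡b (≡.sym (ℕ.*-identityʳ b))))))))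

    -- The local rule is additive, and (x , y , z) is the sum of (x , 0 , z) and (0 , y , 0).
    lbca-middle : (xss : Vector (Vector Carrier b) 3) (i : Fin b) →
                  F (concat xss) i ≈ F (concat (withoutMiddle xss)) i ⊕ (M ·ᵥ xss 1F) i
    lbca-middle xss i = begin
      F (concat xss) i
        ≈⟨ lbca-cong {w = concat xss} split i ⟩
      F (λ k → concat (withoutMiddle xss) k ⊕ concat (onlyMiddle (xss 1F)) k) i
        ≈⟨ bipermutiveRule-+ a (concat (withoutMiddle xss) ∘ position) (concat (onlyMiddle (xss 1F)) ∘ position) ⟩
      F (concat (withoutMiddle xss)) i ⊕ F (concat (onlyMiddle (xss 1F))) i
        ≈⟨ +-congˡ (lbca-onlyMiddle (xss 1F) i) ⟩
      F (concat (withoutMiddle xss)) i ⊕ (M ·ᵥ xss 1F) i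
        ∎
      where
      position = windowPosition (lbca-length b) i

      at : ∀ j l → concat (withoutMiddle xss) (combine j l) ⊕ concat (onlyMiddle (xss 1F)) (combine j l)
                   ≈ withoutMiddle xss j l ⊕ onlyMiddle (xss 1F) j l
      at j l = reflexive (≡.cong₂ _⊕_ (concat-combine (withoutMiddle xss) j l)
                                      (concat-combine (onlyMiddle (xss 1F)) j l))

      blocks : ∀ j l → xss j l ≈ withoutMiddle xss j l ⊕ onlyMiddle (xss 1F) j l
      blocks 0F l = sym (+-identityʳ _)
      blocks 1F l = sym (+-identityˡ _)
      blocks 2F l = sym (+-identityʳ _)

      split : ∀ k → concat xss k ≈ concat (withoutMiddle xss) k ⊕ concat (onlyMiddle (xss 1F)) k
      split = combine-elim 3 _ λ j l →
        trans (reflexive (concat-combine xss j l)) (trans (blocks j l) (sym (at j l)))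

    -- The output has length `b`, so the cells that `cellularAutomaton-cancelˡ` recovers are exactly
    -- those of the first block.
    lbca-injective-first : (xss yss : Vector (Vector Carrier b) 3) →
      (∀ j → xss (suc j) ≋ yss (suc j)) → F (concat xss) ≋ F (concat yss) → xss 0F ≋ yss 0F
    lbca-injective-first xss yss agree Fx≋Fy l =
      trans (reflexive (≡.sym (concat-combine xss 0F l)))
      (trans (cellularAutomaton-cancelˡ _≈_ (lbca-length b) {w = concat xss} {concat yss}
              (bipermutiveRule-cancelˡ a) outside Fx≋Fy (combine {3} 0F l))
      (reflexive (concat-combine yss 0F l)))
      where
      outside : ∀ k → b ≤ toℕ k → concat xss k ≈ concat yss k
      outside = combine-elim 3 _
        λ { 0F j b≤k → contradiction b≤k (ℕ.<⇒≱ (≡.subst (toℕ (combine {3} 0F j) <_)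
              (ℕ.+-identityʳ b) (toℕ-combine-< {3} 0F j)))
          ; (suc i) j _ → trans (reflexive (concat-combine xss (suc i) j))
              (trans (agree i j) (reflexive (≡.sym (concat-combine yss (suc i) j)))) }

    -- Windows have 2b + 1 cells, so `cellularAutomaton-cancelʳ` asks for agreement on the first 2b
    -- cells, that is, on the first two blocks.
    lbca-injective-last : (xss yss : Vector (Vector Carrier b) 3) →
      (∀ j → xss (inject₁ j) ≋ yss (inject₁ j)) → F (concat xss) ≋ F (concat yss) → xss 2F ≋ yss 2F
    lbca-injective-last xss yss agree Fx≋Fy l =
      trans (reflexive (≡.sym (concat-combine xss 2F l)))
      (trans (cellularAutomaton-cancelʳ _≈_ (lbca-length b) {w = concat xss} {concat yss}
              (bipermutiveRule-cancelʳ a) outside Fx≋Fy (combine {3} 2F l))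
      (reflexive (concat-combine yss 2F l)))
      where
      block : ∀ i j → xss i ≋ yss i → concat xss (combine i j) ≈ concat yss (combine i j)
      block i j xᵢ≋yᵢ = trans (reflexive (concat-combine xss i j))
        (trans (xᵢ≋yᵢ j) (reflexive (≡.sym (concat-combine yss i j))))

      outside : ∀ k → toℕ k < suc (2 * b ∸ 1) → concat xss k ≈ concat yss k
      outside = combine-elim 3 _
        λ { 0F j _ → block 0F j (agree 0F)
          ; 1F j _ → block 1F j (agree 1F)
          ; 2F j k<2b → contradiction k<2b (ℕ.≤⇒≯ (≡.subst
              (_≤ toℕ (combine {3} 2F j)) (≡.sym suc[2b∸1]≡2b) (toℕ-combine-≥ {3} 2F j))) }

    -- Lines of the associated hypercube.

    module _ {N ℓ₂} {_≲_ : Rel (Vector Carrier b) ℓ₂} {Ψ : Fin N → Vector Carrier b}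
             (Ψ-iso : IsOrderIsomorphism _≡_ _≋_ _≤ᶠ_ _≲_ Ψ) where

      private
        H : Vector (Fin N) 3 → Fin N
        H = hypercube Ψ-iso F

      open IsOrderIsomorphism Ψ-iso using (injective; surjective)

      -- The same witness as in `hypercube`, so `H i` is `Ψ⁻¹` of the automaton's output by
      -- definition.
      Ψ⁻¹ : Vector Carrier b → Fin N
      Ψ⁻¹ v = proj₁ (surjective v)

      Ψ-Ψ⁻¹ : ∀ v → Ψ (Ψ⁻¹ v) ≋ v
      Ψ-Ψ⁻¹ v = proj₂ (surjective v) ≡.refl

      hypercube≡⇒lbca≋ : {i j : Vector (Fin N) 3} → H i ≡ H j → F (concat (map Ψ i)) ≋ F (concat (map Ψ j))
      hypercube≡⇒lbca≋ {i} {j} Hi≡Hj l = begin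
        F (concat (map Ψ i)) l    ≈⟨ Ψ-Ψ⁻¹ _ l ⟨
        Ψ (H i) l                 ≡⟨ ≡.cong (λ x → Ψ x l) Hi≡Hj ⟩
        Ψ (H j) l                 ≈⟨ Ψ-Ψ⁻¹ _ l ⟩
        F (concat (map Ψ j)) l    ∎

      lbca≋⇒hypercube≡ : {i j : Vector (Fin N) 3} → F (concat (map Ψ i)) ≋ F (concat (map Ψ j)) → H i ≡ H j
      lbca≋⇒hypercube≡ Fi≋Fj = injective (λ l →
        trans (Ψ-Ψ⁻¹ _ l) (trans (Fi≋Fj l) (sym (Ψ-Ψ⁻¹ _ l))))

      module MiddleLine (i : Vector (Fin N) 3) where

        line : Fin N → Vector (Fin N) 3
        line x = updateAt i 1F (const x)

        -- The contribution of the two outer blocks, constant along the line.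
        offset : Vector Carrier b
        offset = F (concat (withoutMiddle (map Ψ i)))

        lbca-line : ∀ x l → F (concat (map Ψ (line x))) l ≈ offset l ⊕ (M ·ᵥ Ψ x) l
        lbca-line x l = trans (lbca-middle (map Ψ (line x)) l) (+-congʳ
          (lbca-cong {w = concat (withoutMiddle (map Ψ (line x)))} {concat (withoutMiddle (map Ψ i))}
              (combine-elim 3 _ same) l))
          where
          -- The middle block is zero on both sides, and `line x` leaves the other two blocks of `i`
          -- alone.
          same : ∀ j r → concat (withoutMiddle (map Ψ (line x))) (combine j r)
                         ≈ concat (withoutMiddle (map Ψ i)) (combine j r)
          same j r = trans (reflexive (concat-combine (withoutMiddle (map Ψ (line x))) j r))
            (trans (outer j) (reflexive (≡.sym (concat-combine (withoutMiddle (map Ψ i)) j r))))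
            where
            outer : ∀ j → withoutMiddle (map Ψ (line x)) j r ≈ withoutMiddle (map Ψ i) j r
            outer 0F = refl
            outer 1F = refl
            outer 2F = refl

        line-injective : Injective _≋_ _≋_ (M ·ᵥ_) → Injective _≡_ _≡_ (H ∘ line)
        line-injective inj {x} {y} Hx≡Hy = injective (inj (λ l → ∙-cancelˡ _ _ _ (begin
          offset l ⊕ (M ·ᵥ Ψ x) l           ≈⟨ lbca-line x l ⟨
          F (concat (map Ψ (line x))) l     ≈⟨ hypercube≡⇒lbca≋ {line x} {line y} Hx≡Hy l ⟩
          F (concat (map Ψ (line y))) l     ≈⟨ lbca-line y l ⟩
          offset l ⊕ (M ·ᵥ Ψ y) l           ∎)))

        -- Since `Ψ` is onto, any two vectors occur as middle blocks on the line; equal images under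
        -- `M` give equal outputs, hence equal entries of `H`.
        toeplitz-injective : Injective _≡_ _≡_ (H ∘ line) → Injective _≋_ _≋_ (M ·ᵥ_)
        toeplitz-injective inj {u} {v} Mu≋Mv l = begin
          u l              ≈⟨ Ψ-Ψ⁻¹ u l ⟨
          Ψ (Ψ⁻¹ u) l      ≡⟨ ≡.cong (λ x → Ψ x l) (inj (lbca≋⇒hypercube≡ {line (Ψ⁻¹ u)} {line (Ψ⁻¹ v)} lines≋)) ⟩
          Ψ (Ψ⁻¹ v) l      ≈⟨ Ψ-Ψ⁻¹ v l ⟩
          v l              ∎
          where
          lines≋ : F (concat (map Ψ (line (Ψ⁻¹ u)))) ≋ F (concat (map Ψ (line (Ψ⁻¹ v))))
          lines≋ l = begin
            F (concat (map Ψ (line (Ψ⁻¹ u)))) l  ≈⟨ lbca-line (Ψ⁻¹ u) l ⟩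
            offset l ⊕ (M ·ᵥ Ψ (Ψ⁻¹ u)) l        ≈⟨ +-congˡ (·ᵥ-congˡ M (Ψ-Ψ⁻¹ u) l) ⟩
            offset l ⊕ (M ·ᵥ u) l                ≈⟨ +-congˡ (Mu≋Mv l) ⟩
            offset l ⊕ (M ·ᵥ v) l                ≈⟨ +-congˡ (·ᵥ-congˡ M (Ψ-Ψ⁻¹ v) l) ⟨
            offset l ⊕ (M ·ᵥ Ψ (Ψ⁻¹ v)) l        ≈⟨ lbca-line (Ψ⁻¹ v) l ⟨
            F (concat (map Ψ (line (Ψ⁻¹ v)))) l  ∎

        toeplitz-surjective : Surjective _≡_ _≡_ (H ∘ line) → ∀ t → ∃ λ y → M ·ᵥ y ≋ t
        toeplitz-surjective surj t = Ψ x , λ l → ∙-cancelˡ (offset l) _ _ (begin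
          offset l ⊕ (M ·ᵥ Ψ x) l          ≈⟨ lbca-line x l ⟨
          F (concat (map Ψ (line x))) l    ≈⟨ Ψ-Ψ⁻¹ _ l ⟨
          Ψ (H (line x)) l                 ≡⟨ ≡.cong (λ z → Ψ z l) (proj₂ (surj target) ≡.refl) ⟩
          Ψ target l                       ≈⟨ Ψ-Ψ⁻¹ _ l ⟩
          offset l ⊕ t l                   ∎)
          where
          -- The shift by `offset` makes the affine equation along the line reduce to `M ·ᵥ y ≋ t`
          -- after cancellation.
          target : Fin N
          target = Ψ⁻¹ (λ l → offset l ⊕ t l)

          x : Fin N
          x = proj₁ (surj target)

      latin⇒invertible : IsLatinCube H → IsInvertibleMatrix M
      latin⇒invertible latin =
        bijective⇒invertible (toeplitz-injective (proj₁ bijective)) (toeplitz-surjective (proj₂ bijective))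
        where
        -- A single middle line determines the behaviour of `M`. The preimage of the zero vector
        -- provides a base point although `N` is abstract.
        i : Vector (Fin N) 3
        i = const (Ψ⁻¹ (const 0#))

        open MiddleLine i

        bijective : Bijective _≡_ _≡_ (H ∘ line)
        bijective = latin i 1F

      invertible⇒latin : IsInvertibleMatrix M → IsLatinCube H
      -- Each line is a map from `Fin N` to itself, so its injectivity suffices.
      invertible⇒latin M-invertible i j = line-injective j , injective⇒surjective (line-injective j)
        where
        line-injective : ∀ j → Injective _≡_ _≡_ (λ x → H (updateAt i j (const x)))
        line-injective 0F {x} {y} Hx≡Hy = injective
          (lbca-injective-first (map Ψ (updateAt i 0F (const x))) (map Ψ (updateAt i 0F (const y)))
            (λ j l → refl) (hypercube≡⇒lbca≋ {updateAt i 0F (const x)} {updateAt i 0F (const y)} Hx≡Hy))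
        line-injective 1F = MiddleLine.line-injective i (invertible⇒injective M-invertible)
        line-injective 2F {x} {y} Hx≡Hy = injective
          (lbca-injective-last (map Ψ (updateAt i 2F (const x))) (map Ψ (updateAt i 2F (const y)))
            (λ { 0F l → refl ; 1F l → refl }) (hypercube≡⇒lbca≋
              {updateAt i 2F (const x)} {updateAt i 2F (const y)} Hx≡Hy))

lemma2 : ∀ {c ℓ₁ ℓ₂ ℓ₃} (q p e : ℕ) .{{_ : NonZero e}} → Prime p → q ≡ p ^ e →
    (𝔽 : FiniteField c ℓ₁ ℓ₂ q) →
    let open FiniteField 𝔽 in
    let open Linear commutativeRing in
    (b : ℕ) .{{_ : NonZero b}} →
    (_≲_ : Rel (Vector Carrier b) ℓ₃) → IsTotalOrder _≋_ _≲_ →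
    (Ψ : Fin (q ^ b) → Vector Carrier b) →
    (Ψ-iso : IsOrderIsomorphism _≡_ _≋_ _≤ᶠ_ _≲_ Ψ) →
    (a : Vector Carrier (2 * b ∸ 1)) →
    IsLatinCube (hypercube {k = 3} Ψ-iso (lbca b a)) ⇔ IsInvertibleMatrix (toeplitz b a)
lemma2 _ _ _ _ _ 𝔽 b _ _ _ Ψ-iso a =
  mk⇔ (latin⇒invertible R b a Ψ-iso) (invertible⇒latin R b a Ψ-iso)
  where R = FiniteField.commutativeRing 𝔽
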